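{- For every nonnegative integers $n$ and $r$ with $n\geqslant\lceil r/2\rceil+1$, $$m\!\left(K_n^2, r\right)=\left\lfloor\frac{(r+1)^2}{4}\right\rfloor.$$
   Context: All graphs are finite, simple and undirected. For an integer $r\geqslant 0$ and a graph $G$, the $r$-neighbor bootstrap percolation process on $G$ starts with a set $A_0\subseteq V(G)$ of initially active vertices, and for $i\geqslant 1$, $A_i=A_{i-1}\cup\{v\in V(G): |N(v)\cap A_{i-1}|\geqslant r\}$, where $N(v)$ is the set of neighbors of $v$. The set $A_0$ is a percolating set if $\bigcup_{i\geqslant 0}A_i=V(G)$. $m(G,r)$ denotes the minimum size of a percolating set of $G$ in the $r$-neighbor bootstrap percolation process. $K_n^2=K_n\square K_n$ is the Cartesian product of two copies of the complete graph $K_n$: its vertex set is $\{0,\ldots,n-1\}^2$ and two vertices are adjacent iff they differ in exactly one coordinate. -}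

module Defs where

open import Data.Nat using (ℕ; zero; suc; _+_; _*_; _≤_; _≥_; _/_; _^_)
open import Data.Bool using (Bool; true; false; _∧_; not; if_then_else_)
open import Data.Fin using (Fin; remQuot)
open import Data.Fin.Properties using (_≟_)
open import Data.List using (List; length; filterᵇ; allFin)
open import Data.Product using (_×_; _,_; proj₁; proj₂; ∃)
open import Relation.Nullary.Decidable using (⌊_⌋)
open import Relation.Binary.PropositionalEquality using (_≡_)

-- A graph on vertex set Fin N, given by a Boolean adjacency relation.
-- (The only graph used, K_n^2 below, is symmetric and irreflexive by construction.)
Graph : ℕ → Set
Graph N = Fin N → Fin N → Bool

adj : ∀ {N} → Graph N → Fin N → Fin N → Bool
adj G = G

VSet : ℕ → Set
VSet N = Fin N → Bool

size : ∀ {N} → VSet N → ℕ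
size {N} A = length (filterᵇ A (allFin N))

nbrCount : ∀ {N} → Graph N → VSet N → Fin N → ℕ
nbrCount {N} G A v = length (filterᵇ (λ u → adj G v u ∧ A u) (allFin N))

step : ∀ {N} → Graph N → ℕ → VSet N → VSet N
step G r A v = if A v then true else ⌊ r Data.Nat.≤? nbrCount G A v ⌋

active : ∀ {N} → Graph N → ℕ → VSet N → ℕ → VSet N
active G r A zero    = A
active G r A (suc i) = step G r (active G r A i)

Percolates : ∀ {N} → Graph N → ℕ → VSet N → Set
Percolates {N} G r A = ∀ (v : Fin N) → ∃ λ i → active G r A i v ≡ true

IsMinPercolatingSize : ∀ {N} → Graph N → ℕ → ℕ → Set
IsMinPercolatingSize G r k =
  (∃ λ A → Percolates G r A × size A ≡ k)
  × (∀ A → Percolates G r A → k ≤ size A)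

-- K_n □ K_n on vertex set Fin (n * n) ≅ Fin n × Fin n (via remQuot);
-- (a,b) ~ (c,d) iff they differ in exactly one coordinate.
K2adj : (n : ℕ) → Fin (n * n) → Fin (n * n) → Bool
K2adj n u v with remQuot {n} n u | remQuot {n} n v
... | (a , b) | (c , d) =
  (⌊ a ≟ c ⌋ ∧ not ⌊ b ≟ d ⌋) Data.Bool.∨ (not ⌊ a ≟ c ⌋ ∧ ⌊ b ≟ d ⌋)

K2 : (n : ℕ) → Graph (n * n)
K2 n = K2adj n

{-# OPTIONS --safe #-}

-- Lower bound: the first vertex to be infected has r initially active vertices in its row and
-- column. Deleting this row and column removes two neighbours of every other vertex, so the
-- remaining seeds percolate in K_{n-1}² with threshold r − 2, and m(r) ≥ r + m(r − 2).
-- Upper bound: with p = ⌈r/2⌉ and q = ⌊r/2⌋, activate the two corner triangles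
-- { j − i ≥ n − p } and { i − j ≥ n − q }, of sizes p(p+1)/2 and q(q+1)/2. The other vertices
-- become active antidiagonal by antidiagonal.
module Submission where

open import Defs
open import Data.Nat using (ℕ; _+_; _*_; _≥_; _/_)
open import Data.Nat using (zero; suc; _∸_; _≤_; _<_; z≤n; s≤s; _≤?_; ⌊_/2⌋; ⌈_/2⌉)
open import Data.Nat.Properties hiding (_≟_)
open import Data.Nat.Divisibility using (divides)
open import Data.Nat.DivMod using (+-distrib-/-∣ʳ; m*n/n≡m)
open import Data.Nat.Tactic.RingSolver using (solve-∀)
open import Algebra.Properties.CommutativeMonoid.Sum +-0-commutativeMonoid
open import Data.Bool using (Bool; true; false; if_then_else_; _∧_; _∨_; not)
import Data.Bool.Properties as Bool
open import Data.Fin using (Fin; zero; suc; toℕ; combine; remQuot; punchIn; punchOut; _↑ˡ_; _↑ʳ_)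
open import Data.Fin.Properties
  using (_≟_; any?; remQuot-combine; combine-remQuot; punchIn-punchOut; toℕ<n)
open import Data.List using (length; filterᵇ; tabulate)
open import Data.Product using (_×_; _,_; ∃₂; proj₁; proj₂; uncurry)
open import Data.Sum using (_⊎_; inj₁; inj₂)
open import Data.Vec.Functional using (insertAt)
open import Data.Vec.Functional.Properties using (insertAt-lookup; insertAt-punchIn)
open import Function using (_∘_; _$_; id)
open import Relation.Nullary using (Dec; yes; no; ¬_; contradiction)
open import Relation.Nullary.Decidable using (⌊_⌋; _×-dec_; _⊎-dec_)
open import Relation.Binary.PropositionalEquality
  using (_≡_; refl; sym; trans; cong; cong₂; subst; module ≡-Reasoning)

-- Boolean grids and their row and column counts.

Grid : ℕ → Set
Grid n = Fin n → Fin n → Bool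

private variable
  m n r : ℕ

ind : Bool → ℕ
ind b = if b then 1 else 0

count : (Fin n → Bool) → ℕ
count f = sum (ind ∘ f)

row col : Grid n → Fin n → ℕ
row B a = count (B a)
col B b = count (λ c → B c b)

total : Grid n → ℕ
total {n} B = ∑[ c < n ] row B c

grid : ∀ n → VSet (n * n) → Grid n
grid n A c d = A (combine c d)

-- Finite sums

sum-mono-≤ : {f g : Fin n → ℕ} → (∀ i → f i ≤ g i) → sum f ≤ sum g
sum-mono-≤ {zero}  f≤g = z≤n
sum-mono-≤ {suc n} f≤g = +-mono-≤ (f≤g zero) (sum-mono-≤ (f≤g ∘ suc))

ind-mono : ∀ {b c} → (b ≡ true → c ≡ true) → ind b ≤ ind c
ind-mono {false}    b⇒c = z≤n
ind-mono {true} {c} b⇒c rewrite b⇒c refl = ≤-refl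

count-mono : {f g : Fin n → Bool} → (∀ i → f i ≡ true → g i ≡ true) → count f ≤ count g
count-mono f⇒g = sum-mono-≤ (λ i → ind-mono (f⇒g i))

count-true : {f : Fin n → Bool} → (∀ i → f i ≡ true) → count f ≡ n
count-true {zero}  f≡true = refl
count-true {suc n} f≡true = cong₂ _+_ (cong ind (f≡true zero)) (count-true (f≡true ∘ suc))

sum-zero : ∀ n → ∑[ i < n ] 0 ≡ 0
sum-zero zero    = refl
sum-zero (suc n) = sum-zero n

sum-δ : ∀ (a : Fin n) (f : Fin n → ℕ) → ∑[ c < n ] (if ⌊ a ≟ c ⌋ then f c else 0) ≡ f a
sum-δ {suc n} zero f = trans (cong (f zero +_) (sum-zero n)) (+-identityʳ _)
sum-δ (suc a) f = trans (sum-cong-≗ shift) (sum-δ a (f ∘ suc))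
  where
  shift : ∀ c → (if ⌊ suc a ≟ suc c ⌋ then f (suc c) else 0) ≡ (if ⌊ a ≟ c ⌋ then f (suc c) else 0)
  shift c with a ≟ c
  ... | yes _ = refl
  ... | no  _ = refl

sum-+ : ∀ m (f : Fin (m + n) → ℕ) → sum f ≡ ∑[ i < m ] f (i ↑ˡ n) + ∑[ j < n ] f (m ↑ʳ j)
sum-+ zero    f = refl
sum-+ (suc m) f = trans (cong (f zero +_) (sum-+ m (f ∘ suc))) (sym (+-assoc (f zero) _ _))

sum-combine : ∀ m (f : Fin (m * n) → ℕ) → sum f ≡ ∑[ i < m ] ∑[ j < n ] f (combine i j)
sum-combine     zero    f = refl
sum-combine {n} (suc m) f =
  trans (sum-+ n f) (cong (∑[ j < n ] f (j ↑ˡ (m * n)) +_) (sum-combine m (f ∘ (n ↑ʳ_))))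

length-filter-tabulate : ∀ {X : Set} (P : X → Bool) (f : Fin n → X) →
                         length (filterᵇ P (tabulate f)) ≡ count (P ∘ f)
length-filter-tabulate {zero}  P f = refl
length-filter-tabulate {suc n} P f with P (f zero)
... | true  = cong suc (length-filter-tabulate P (f ∘ suc))
... | false = length-filter-tabulate P (f ∘ suc)

-- Translation to grids

size≡total : ∀ n (A : VSet (n * n)) → size A ≡ total (grid n A)
size≡total n A = trans (length-filter-tabulate {n * n} A id) (sum-combine n (ind ∘ A))

rookAdj : Fin n × Fin n → Fin n × Fin n → Bool
rookAdj (a , b) (c , d) = (⌊ a ≟ c ⌋ ∧ not ⌊ b ≟ d ⌋) ∨ (not ⌊ a ≟ c ⌋ ∧ ⌊ b ≟ d ⌋)

K2-combine : (a b c d : Fin n) →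
             K2 n (combine a b) (combine c d) ≡ rookAdj (a , b) (c , d)
K2-combine a b c d = cong₂ rookAdj (remQuot-combine a b) (remQuot-combine c d)

-- An inactive vertex contributes nothing to its own row and column, so these can be counted in full.
nbrCount≡row+col : (A : VSet (n * n)) (a b : Fin n) → grid n A a b ≡ false →
                   nbrCount (K2 n) A (combine a b) ≡ row (grid n A) a + col (grid n A) b
nbrCount≡row+col {n} A a b inactive = begin
  nbrCount (K2 n) A (combine a b)
    ≡⟨ length-filter-tabulate {n * n} (λ u → K2 n (combine a b) u ∧ A u) id ⟩
  count (λ u → K2 n (combine a b) u ∧ A u)
    ≡⟨ sum-combine n _ ⟩
  ∑[ c < n ] ∑[ d < n ] ind (K2 n (combine a b) (combine c d) ∧ B c d)
    ≡⟨ sum-cong-≗ (λ c → trans (sum-cong-≗ (split c)) (∑-distrib-+ (inRow c) (inCol c))) ⟩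
  ∑[ c < n ] (∑[ d < n ] inRow c d + ∑[ d < n ] inCol c d)
    ≡⟨ ∑-distrib-+ (λ c → ∑[ d < n ] inRow c d) (λ c → ∑[ d < n ] inCol c d) ⟩
  ∑[ c < n ] ∑[ d < n ] inRow c d + ∑[ c < n ] ∑[ d < n ] inCol c d
    ≡⟨ cong₂ _+_
         -- The test in `inRow` involves only `c`, so the sum over `c` is moved inside, where
         -- `sum-δ` picks out row `a`.
         (trans (∑-comm inRow) (sum-cong-≗ (λ d → sum-δ a (λ c → ind (B c d)))))
         (sum-cong-≗ (λ c → sum-δ b (ind ∘ B c))) ⟩
  row B a + col B b ∎
  where
  open ≡-Reasoning
  B = grid n A
  inRow inCol : Fin n → Fin n → ℕ
  inRow c d = if ⌊ a ≟ c ⌋ then ind (B c d) else 0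
  inCol c d = if ⌊ b ≟ d ⌋ then ind (B c d) else 0
  split : ∀ c d → ind (K2 n (combine a b) (combine c d) ∧ B c d) ≡ inRow c d + inCol c d
  split c d rewrite K2-combine a b c d with a ≟ c | b ≟ d
  ... | yes refl | yes refl rewrite inactive = refl
  ... | yes _    | no _     = sym (+-identityʳ _)
  ... | no _     | yes _    = refl
  ... | no _     | no _     = refl

step-extensive : (G : Graph n) (A : VSet n) (v : Fin n) → A v ≡ true → step G r A v ≡ true
step-extensive G A v Av rewrite Av = refl

step-activates : (A : VSet (n * n)) (a b : Fin n) →
                 (grid n A a b ≡ false → r ≤ row (grid n A) a + col (grid n A) b) →
                 step (K2 n) r A (combine a b) ≡ true
step-activates {n} {r} A a b enough with A (combine a b) in eq
... | true = refl
... | false with r ≤? nbrCount (K2 n) A (combine a b)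
...   | yes _ = refl
...   | no r≰ = contradiction (subst (r ≤_) (sym (nbrCount≡row+col A a b eq)) (enough refl)) r≰

step-active⇒ : (A : VSet (n * n)) (a b : Fin n) → step (K2 n) r A (combine a b) ≡ true →
               grid n A a b ≡ true ⊎ r ≤ row (grid n A) a + col (grid n A) b
step-active⇒ {n} {r} A a b act with A (combine a b) in eq
... | true = inj₁ refl
... | false with r ≤? nbrCount (K2 n) A (combine a b)
...   | yes r≤ = inj₂ (subst (r ≤_) (nbrCount≡row+col A a b eq) r≤)
step-active⇒ {n} {r} A a b () | false | no _

-- Lower bound

_⊑_ : Grid n → Grid n → Set
A ⊑ B = ∀ c d → A c d ≡ true → B c d ≡ true

Full : Grid n → Set
Full B = ∀ c d → B c d ≡ true

-- The counts include the vertex `(c , d)` itself. This is harmless: it adds to them only when it is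
-- active, and then the conclusion holds anyway.
Closed : ℕ → Grid n → Set
Closed r B = ∀ c d → r ≤ row B c + col B d → B c d ≡ true

-- Percolation without the time parameter: no proper closed set contains `A`. In this form a
-- deletion of lines is handled by enlarging closed sets, with no need to follow the process step by
-- step.
Generates : ℕ → Grid n → Set
Generates r A = ∀ B → A ⊑ B → Closed r B → Full B

-- Induction on time: row and column counts are monotone, so a vertex activated at the next step
-- also meets the threshold in `B`.
active⊑closed : (A : VSet (n * n)) (B : Grid n) → grid n A ⊑ B → Closed r B →
                ∀ t → grid n (active (K2 n) r A t) ⊑ B
active⊑closed A B A⊑B closed zero = A⊑B
active⊑closed {n} {r} A B A⊑B closed (suc t) c d act with step-active⇒ (active (K2 n) r A t) c d act
... | inj₁ before = active⊑closed A B A⊑B closed t c d before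
... | inj₂ r≤     = closed c d (≤-trans r≤ (+-mono-≤ (count-mono (λ d′ → ih c d′))
                                                    (count-mono (λ c′ → ih c′ d))))
  where ih = active⊑closed A B A⊑B closed t

percolates⇒generates : (A : VSet (n * n)) → Percolates (K2 n) r A → Generates r (grid n A)
percolates⇒generates A perc B A⊑B closed c d =
  let t , act = perc (combine c d) in active⊑closed A B A⊑B closed t c d act

-- Deleting a row and a column, and restoring them.

minor : Grid (suc n) → Fin (suc n) → Fin (suc n) → Grid n
minor A a b c d = A (punchIn a c) (punchIn b d)

-- A right inverse of `minor`: the deleted row and column come back fully active, which turns a
-- closed superset of the minor into one of the original grid.
extend : Fin (suc n) → Fin (suc n) → Grid n → Grid (suc n)
extend a b B = insertAt (λ c → insertAt (B c) b true) a (λ _ → true)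

module _ (a b : Fin (suc n)) (B : Grid n) where

  extend-row : ∀ d → extend a b B a d ≡ true
  extend-row d = cong (_$ d) (insertAt-lookup (λ c → insertAt (B c) b true) a (λ _ → true))

  extend-minor-row : ∀ c d → extend a b B (punchIn a c) d ≡ insertAt (B c) b true d
  extend-minor-row c d =
    cong (_$ d) (insertAt-punchIn (λ c → insertAt (B c) b true) a (λ _ → true) c)

  extend-minor : ∀ c d → extend a b B (punchIn a c) (punchIn b d) ≡ B c d
  extend-minor c d = trans (extend-minor-row c (punchIn b d)) (insertAt-punchIn (B c) b true d)

data PunchView (a : Fin (suc n)) : Fin (suc n) → Set where
  here  : PunchView a a
  there : ∀ c → PunchView a (punchIn a c)

punchView : (a c : Fin (suc n)) → PunchView a c
punchView a c with a ≟ c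
... | yes refl = here
... | no a≢c   = subst (PunchView a) (punchIn-punchOut a≢c) (there (punchOut a≢c))

extend-col : ∀ (a b : Fin (suc n)) B c → extend a b B c b ≡ true
extend-col a b B c with punchView a c
... | here    = extend-row a b B b
... | there c = trans (extend-minor-row a b B c b) (insertAt-lookup (B c) b true)

row-extend : ∀ (a b : Fin (suc n)) B c → row (extend a b B) (punchIn a c) ≡ suc (row B c)
row-extend a b B c = trans (sum-remove {i = b} (ind ∘ extend a b B (punchIn a c)))
  (cong₂ _+_ (cong ind (extend-col a b B (punchIn a c)))
             (sum-cong-≗ (λ d → cong ind (extend-minor a b B c d))))

col-extend : ∀ (a b : Fin (suc n)) B d → col (extend a b B) (punchIn b d) ≡ suc (col B d)
col-extend a b B d = trans (sum-remove {i = a} (λ c → ind (extend a b B c (punchIn b d))))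
  (cong₂ _+_ (cong ind (extend-row a b B (punchIn b d)))
             (sum-cong-≗ (λ c → cong ind (extend-minor a b B c d))))

-- Each remaining vertex has exactly two neighbours in the deleted row and column.
minor-generates : (a b : Fin (suc n)) (A : Grid (suc n)) →
                  Generates (2 + r) A → Generates r (minor A a b)
minor-generates {r = r} a b A gen B A′⊑B closed c d =
  trans (sym (extend-minor a b B c d)) (gen (extend a b B) A⊑B⁺ closed⁺ (punchIn a c) (punchIn b d))
  where
  A⊑B⁺ : A ⊑ extend a b B
  A⊑B⁺ c d Acd with punchView a c | punchView b d
  ... | here    | _       = extend-row a b B d
  ... | there c | here    = extend-col a b B (punchIn a c)
  ... | there c | there d = trans (extend-minor a b B c d) (A′⊑B c d Acd)
  closed⁺ : Closed (2 + r) (extend a b B)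
  closed⁺ c d r≤ with punchView a c | punchView b d
  ... | here    | _       = extend-row a b B d
  ... | there c | here    = extend-col a b B (punchIn a c)
  ... | there c | there d = trans (extend-minor a b B c d) (closed c d (+-cancelˡ-≤ 2 _ _ (begin
    2 + r                                                           ≤⟨ r≤ ⟩
    row (extend a b B) (punchIn a c) + col (extend a b B) (punchIn b d)
      ≡⟨ cong₂ _+_ (row-extend a b B c) (col-extend a b B d) ⟩
    suc (row B c) + suc (col B d)                                   ≡⟨ cong suc (+-suc _ _) ⟩
    2 + (row B c + col B d)                                         ∎)))
    where open ≤-Reasoning

-- The crossing vertex `(a , b)` lies in both its row and its column; adding it on the left balances
-- this double count without subtraction.
total-minor : (a b : Fin (suc n)) (A : Grid (suc n)) →
              ind (A a b) + total A ≡ row A a + col A b + total (minor A a b)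
total-minor {n} a b A = begin
  x + total A                                        ≡⟨ cong (x +_) (sum-remove {i = a} (row A)) ⟩
  x + (R + ∑[ c < n ] row A (punchIn a c))
    ≡⟨ cong (λ s → x + (R + s)) (trans (sum-cong-≗ (λ c → sum-remove {i = b} (ind ∘ A (punchIn a c))))
                                       (∑-distrib-+ _ (row (minor A a b)))) ⟩
  x + (R + (y + t))                                  ≡⟨ rearr x R y t ⟩
  R + (x + y) + t
    ≡⟨ cong (λ s → R + s + t) (sym (sum-remove {i = a} (λ c → ind (A c b)))) ⟩
  R + col A b + t                                    ∎
  where
  open ≡-Reasoning
  x = ind (A a b)
  R = row A a
  y = ∑[ c < n ] ind (A (punchIn a c) b)
  t = total (minor A a b)
  rearr : ∀ x R y t → x + (R + (y + t)) ≡ R + (x + y) + t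
  rearr = solve-∀

-- Quarter squares and halves.

quarterSquare : ℕ → ℕ
quarterSquare 0 = 0
quarterSquare 1 = 1
quarterSquare (suc (suc r)) = (2 + r) + quarterSquare r

-- The recursion by steps of two, which mirrors the peeling of the grid, matches (r + 3)² = (r + 1)²
-- + 4(r + 2).
quarterSquare≡ : ∀ r → quarterSquare r ≡ ((r + 1) * (r + 1)) / 4
quarterSquare≡ 0 = refl
quarterSquare≡ 1 = refl
quarterSquare≡ (suc (suc r)) = sym (begin
  (2 + r + 1) * (2 + r + 1) / 4                   ≡⟨ cong (_/ 4) (expand r) ⟩
  ((r + 1) * (r + 1) + (2 + r) * 4) / 4
    ≡⟨ +-distrib-/-∣ʳ ((r + 1) * (r + 1)) (divides (2 + r) refl) ⟩
  (r + 1) * (r + 1) / 4 + (2 + r) * 4 / 4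
    ≡⟨ cong₂ _+_ (sym (quarterSquare≡ r)) (m*n/n≡m (2 + r) 4) ⟩
  quarterSquare r + (2 + r)                       ≡⟨ +-comm (quarterSquare r) _ ⟩
  (2 + r) + quarterSquare r                       ∎)
  where
  open ≡-Reasoning
  expand : ∀ r → (2 + r + 1) * (2 + r + 1) ≡ (r + 1) * (r + 1) + (2 + r) * 4
  expand = solve-∀

n/2≡⌊n/2⌋ : ∀ n → n / 2 ≡ ⌊ n /2⌋
n/2≡⌊n/2⌋ 0 = refl
n/2≡⌊n/2⌋ 1 = refl
n/2≡⌊n/2⌋ (suc (suc n)) = begin
  (2 + n) / 2   ≡⟨ cong (_/ 2) (+-comm 2 n) ⟩
  (n + 2) / 2   ≡⟨ +-distrib-/-∣ʳ n (divides 1 refl) ⟩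
  n / 2 + 1     ≡⟨ +-comm _ 1 ⟩
  suc (n / 2)   ≡⟨ cong suc (n/2≡⌊n/2⌋ n) ⟩
  suc ⌊ n /2⌋   ∎
  where open ≡-Reasoning

n≤2⌈n/2⌉ : ∀ n → n ≤ ⌈ n /2⌉ + ⌈ n /2⌉
n≤2⌈n/2⌉ n = subst (_≤ ⌈ n /2⌉ + ⌈ n /2⌉) (⌊n/2⌋+⌈n/2⌉≡n n) (+-monoˡ-≤ _ (⌊n/2⌋≤⌈n/2⌉ n))

-- Either some inactive vertex already has `r` active neighbours, or `A` is closed and hence full.
-- In a full grid any cross works: its two counts add up to `2n + 2`, which is at least `1 + r`.
∃-heavy-cross : (A : Grid (suc n)) → Generates r A → r ≤ n + n →
                ∃₂ λ a b → ind (A a b) + r ≤ row A a + col A b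
∃-heavy-cross {n} {r} A gen r≤2n
  with any? (λ a → any? (λ b → (A a b Bool.≟ false) ×-dec (r ≤? row A a + col A b)))
... | yes (a , b , inactive , r≤) = a , b , subst (λ x → ind x + r ≤ row A a + col A b) (sym inactive) r≤
... | no none = zero , zero , (begin
  ind (A zero zero) + r        ≡⟨ cong (λ x → ind x + r) (full zero zero) ⟩
  suc r                        ≤⟨ s≤s r≤2n ⟩
  suc (n + n)                  ≤⟨ n≤1+n _ ⟩
  suc (suc (n + n))            ≡⟨ cong suc (sym (+-suc n n)) ⟩
  suc n + suc n                ≡⟨ sym (cong₂ _+_ (count-true (full zero)) (count-true (λ c → full c zero))) ⟩
  row A zero + col A zero      ∎)
  where
  open ≤-Reasoning
  closed : Closed r A
  closed c d r≤ with A c d in eq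
  ... | true  = refl
  ... | false = contradiction (c , d , eq , r≤) none
  full : Full A
  full = gen A (λ _ _ → id) closed

-- Deleting a heavy cross lowers the threshold by two and the side by one, so `⌈ r /2⌉ < n` survives
-- the induction.
quarterSquare≤total : ∀ r (A : Grid n) → Generates r A → ⌈ r /2⌉ < n → quarterSquare r ≤ total A
quarterSquare≤total 0 A gen _ = z≤n
quarterSquare≤total {suc n} r@(suc r′) A gen (s≤s h≤n) = +-cancelˡ-≤ (ind (A a b)) _ _ (begin
  ind (A a b) + quarterSquare r       ≤⟨ +-monoʳ-≤ (ind (A a b)) (peel r′ gen h≤n) ⟩
  ind (A a b) + (r + total (minor A a b))  ≡⟨ sym (+-assoc (ind (A a b)) r _) ⟩
  ind (A a b) + r + total (minor A a b)    ≤⟨ +-monoˡ-≤ _ heavy ⟩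
  row A a + col A b + total (minor A a b)  ≡⟨ sym (total-minor a b A) ⟩
  ind (A a b) + total A               ∎)
  where
  open ≤-Reasoning
  cross = ∃-heavy-cross A gen (≤-trans (n≤2⌈n/2⌉ r) (+-mono-≤ h≤n h≤n))
  a = proj₁ cross
  b = proj₁ (proj₂ cross)
  heavy = proj₂ (proj₂ cross)
  -- Splits off threshold 1, where the cross alone supplies the bound, from thresholds of at least
  -- 2, where the minor is used.
  peel : ∀ r → Generates (suc r) A → ⌈ suc r /2⌉ ≤ n →
         quarterSquare (suc r) ≤ suc r + total (minor A a b)
  peel 0       _   _   = s≤s z≤n
  peel (suc r) gen h≤n = +-monoʳ-≤ (2 + r) (quarterSquare≤total r (minor A a b) (minor-generates a b A gen) h≤n)

-- Upper bound

count≤ : ∀ y (f : Fin n → Bool) → (∀ j → f j ≡ true → y ≤ toℕ j) → count f ≤ n ∸ y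
count≤ {zero}  y       f h = z≤n
count≤ {suc n} zero    f h = +-mono-≤ (ind-mono {f zero} {true} (λ _ → refl)) (count≤ zero (f ∘ suc) (λ _ _ → z≤n))
count≤ {suc n} (suc y) f h with f zero in eq
... | true  = contradiction (h zero eq) (λ ())
... | false = count≤ y (f ∘ suc) (λ j fj → ≤-pred (h (suc j) fj))

-- Since `x ≤ y`, the first `x` indices and those from `y` on are disjoint, so their numbers add.
count≥ : ∀ x y (f : Fin n → Bool) → x ≤ y → x ≤ n →
         (∀ j → toℕ j < x ⊎ y ≤ toℕ j → f j ≡ true) → x + (n ∸ y) ≤ count f
count≥ {zero}  zero    y       f x≤y x≤n h = ≤-reflexive (0∸n≡0 y)
count≥ {suc n} zero    zero    f x≤y x≤n h = ≤-reflexive (sym (count-true (λ j → h j (inj₂ z≤n))))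
count≥ {suc n} zero    (suc y) f x≤y x≤n h =
  ≤-trans (count≥ zero y (f ∘ suc) z≤n z≤n (λ { j (inj₂ y≤j) → h (suc j) (inj₂ (s≤s y≤j)) }))
          (m≤n+m _ (ind (f zero)))
count≥ {suc n} (suc x) (suc y) f (s≤s x≤y) (s≤s x≤n) h rewrite h zero (inj₁ (s≤s z≤n)) =
  s≤s (count≥ x y (f ∘ suc) x≤y x≤n
    (λ { j (inj₁ j<x) → h (suc j) (inj₁ (s≤s j<x)) ; j (inj₂ y≤j) → h (suc j) (inj₂ (s≤s y≤j)) }))

triangle : ℕ → ℕ
triangle zero    = 0
triangle (suc p) = suc p + triangle p

∑-∸≤triangle : ∀ n p → ∑[ i < n ] (p ∸ toℕ i) ≤ triangle p
∑-∸≤triangle zero    p       = z≤n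
∑-∸≤triangle (suc n) zero    = ≤-reflexive (trans (sum-cong-≗ {suc n} (λ i → 0∸n≡0 (toℕ i))) (sum-zero (suc n)))
∑-∸≤triangle (suc n) (suc p) = +-monoʳ-≤ (suc p) (∑-∸≤triangle n p)

-- Raising `r` by two lengthens each triangle by one line, and the two new lines have `2 + r`
-- vertices together.
quarterSquare≡triangles : ∀ r → quarterSquare r ≡ triangle ⌈ r /2⌉ + triangle ⌊ r /2⌋
quarterSquare≡triangles 0 = refl
quarterSquare≡triangles 1 = refl
quarterSquare≡triangles (suc (suc r)) = begin
  2 + r + quarterSquare r
    ≡⟨ cong₂ (λ x y → 2 + x + y) (sym (⌊n/2⌋+⌈n/2⌉≡n r)) (quarterSquare≡triangles r) ⟩
  2 + (⌊ r /2⌋ + ⌈ r /2⌉) + (triangle ⌈ r /2⌉ + triangle ⌊ r /2⌋)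
    ≡⟨ rearr ⌊ r /2⌋ ⌈ r /2⌉ (triangle ⌈ r /2⌉) (triangle ⌊ r /2⌋) ⟩
  (suc ⌈ r /2⌉ + triangle ⌈ r /2⌉) + (suc ⌊ r /2⌋ + triangle ⌊ r /2⌋) ∎
  where
  open ≡-Reasoning
  rearr : ∀ f c x y → 2 + (f + c) + (x + y) ≡ (suc c + x) + (suc f + y)
  rearr = solve-∀

-- With `m` as the side of the grid, this bounds the number of places that the upper triangle
-- occupies in row `i`.
m∸[m+i∸p]≤p∸i : ∀ m i p → m ∸ (m + i ∸ p) ≤ p ∸ i
m∸[m+i∸p]≤p∸i m i p = m≤n+o⇒m∸n≤o m (m + i ∸ p) (+-cancelʳ-≤ i _ _ (begin
  m + i                       ≤⟨ m≤n+m∸n (m + i) p ⟩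
  p + (m + i ∸ p)             ≤⟨ +-monoˡ-≤ _ (m≤n+m∸n p i) ⟩
  i + (p ∸ i) + (m + i ∸ p)   ≡⟨ rearr i (p ∸ i) (m + i ∸ p) ⟩
  m + i ∸ p + (p ∸ i) + i     ∎))
  where
  open ≤-Reasoning
  rearr : ∀ i x y → i + x + y ≡ y + x + i
  rearr = solve-∀

-- Here `p ≤ m` keeps `m + i ∸ p` from being truncated, so the line really has room for `p ∸ i`
-- seeds.
p∸i≤m∸[m+i∸p] : ∀ m i p → p ≤ m → p ∸ i ≤ m ∸ (m + i ∸ p)
p∸i≤m∸[m+i∸p] m i p p≤m with ≤-total p i
... | inj₁ p≤i rewrite m≤n⇒m∸n≡0 p≤i = z≤n
... | inj₂ i≤p = ≤-reflexive (sym (begin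
  m ∸ (m + i ∸ p)             ≡⟨ cong₂ (λ x y → m ∸ (x ∸ y)) (+-comm m i) (sym (m+[n∸m]≡n i≤p)) ⟩
  m ∸ (i + m ∸ (i + (p ∸ i))) ≡⟨ cong (m ∸_) ([m+n]∸[m+o]≡n∸o i m (p ∸ i)) ⟩
  m ∸ (m ∸ (p ∸ i))           ≡⟨ m∸[m∸n]≡n (≤-trans (m∸n≤m p i) p≤m) ⟩
  p ∸ i                       ∎))
  where open ≡-Reasoning

-- The two corner triangles and their percolation.

module Construction (n p q : ℕ) where

  -- Row i is seeded in its last p ∸ i places, column j in its last q ∸ j places
  -- (n + i ∸ p is not truncated, as p ≤ n wherever percolation is claimed).
  Seed : (i j : Fin n) → Set
  Seed i j = n + toℕ i ∸ p ≤ toℕ j ⊎ n + toℕ j ∸ q ≤ toℕ i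

  upper? : (i j : Fin n) → Dec (n + toℕ i ∸ p ≤ toℕ j)
  upper? i j = n + toℕ i ∸ p ≤? toℕ j

  lower? : (i j : Fin n) → Dec (n + toℕ j ∸ q ≤ toℕ i)
  lower? i j = n + toℕ j ∸ q ≤? toℕ i

  seed? : (i j : Fin n) → Dec (Seed i j)
  seed? i j = upper? i j ⊎-dec lower? i j

  seeds : VSet (n * n)
  seeds v = uncurry (λ i j → ⌊ seed? i j ⌋) (remQuot {n} n v)

  grid-seeds : ∀ i j → grid n seeds i j ≡ ⌊ seed? i j ⌋
  grid-seeds i j = cong (uncurry (λ i j → ⌊ seed? i j ⌋)) (remQuot-combine i j)

  size-seeds : size seeds ≤ triangle p + triangle q
  size-seeds = begin
    size seeds
      ≡⟨ size≡total n seeds ⟩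
    total (grid n seeds)
      -- A vertex in both triangles would be counted twice, which an upper bound tolerates.
      ≤⟨ sum-mono-≤ (λ i → sum-mono-≤ (split i)) ⟩
    ∑[ i < n ] ∑[ j < n ] (up i j + low i j)
      ≡⟨ trans (sum-cong-≗ (λ i → ∑-distrib-+ (up i) (low i)))
               (∑-distrib-+ (λ i → sum (up i)) (λ i → sum (low i))) ⟩
    ∑[ i < n ] ∑[ j < n ] up i j + ∑[ i < n ] ∑[ j < n ] low i j
      -- The upper triangle is counted by rows, the lower one by columns.
      ≡⟨ cong (∑[ i < n ] sum (up i) +_) (∑-comm low) ⟩
    ∑[ i < n ] ∑[ j < n ] up i j + ∑[ j < n ] ∑[ i < n ] low i j
      ≤⟨ +-mono-≤ (sum-mono-≤ (λ i → ≤-trans (count≤ _ _ (λ j → fromTrue (upper? i j)))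
                                              (m∸[m+i∸p]≤p∸i n (toℕ i) p)))
                  (sum-mono-≤ (λ j → ≤-trans (count≤ _ _ (λ i → fromTrue (lower? i j)))
                                              (m∸[m+i∸p]≤p∸i n (toℕ j) q))) ⟩
    ∑[ i < n ] (p ∸ toℕ i) + ∑[ j < n ] (q ∸ toℕ j)
      ≤⟨ +-mono-≤ (∑-∸≤triangle n p) (∑-∸≤triangle n q) ⟩
    triangle p + triangle q ∎
    where
    open ≤-Reasoning
    up low : Fin n → Fin n → ℕ
    up  i j = ind ⌊ upper? i j ⌋
    low i j = ind ⌊ lower? i j ⌋
    fromTrue : ∀ {P : Set} (P? : Dec P) → ⌊ P? ⌋ ≡ true → P
    fromTrue (yes p) _ = p
    split : ∀ i j → ind (grid n seeds i j) ≤ up i j + low i j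
    split i j rewrite grid-seeds i j with upper? i j | lower? i j
    ... | yes _ | _     = s≤s z≤n
    ... | no _  | yes _ = ≤-refl
    ... | no _  | no _  = z≤n

  module _ (p≤n : p ≤ n) (q≤n : q ≤ n) where

    seeds-active : ∀ t i j → Seed i j → grid n (active (K2 n) (p + q) seeds t) i j ≡ true
    seeds-active zero i j s rewrite grid-seeds i j with seed? i j
    ... | yes _ = refl
    ... | no ¬s = contradiction s ¬s
    seeds-active (suc t) i j s =
      step-extensive (K2 n) (active (K2 n) (p + q) seeds t) (combine i j) (seeds-active t i j s)

    -- If all vertices on earlier antidiagonals are active, an inactive (i , j) sees the first j and
    -- the last p ∸ i vertices of its row, and the first i and the last q ∸ j of its column.
    antidiagonal-active : ∀ t i j → toℕ i + toℕ j < t →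
                          grid n (active (K2 n) (p + q) seeds t) i j ≡ true
    antidiagonal-active (suc t) i j (s≤s i+j≤t) = step-activates A i j enough
      where
      open ≤-Reasoning
      A = active (K2 n) (p + q) seeds t
      ¬seed : grid n A i j ≡ false → ¬ Seed i j
      ¬seed inactive s with () ← trans (sym inactive) (seeds-active t i j s)
      rearr : ∀ i x j y → (i + x) + (j + y) ≡ (j + x) + (i + y)
      rearr = solve-∀
      enough : grid n A i j ≡ false → p + q ≤ row (grid n A) i + col (grid n A) j
      enough inactive = begin
        p + q
          ≤⟨ +-mono-≤ (m≤n+m∸n p (toℕ i)) (m≤n+m∸n q (toℕ j)) ⟩
        (toℕ i + (p ∸ toℕ i)) + (toℕ j + (q ∸ toℕ j))
          -- The coordinates trade places: row `i` has `toℕ j` vertices before `(i , j)`, and column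
          -- `j` has `toℕ i`.
          ≡⟨ rearr (toℕ i) (p ∸ toℕ i) (toℕ j) (q ∸ toℕ j) ⟩
        (toℕ j + (p ∸ toℕ i)) + (toℕ i + (q ∸ toℕ j))
          ≤⟨ +-mono-≤ (+-monoʳ-≤ (toℕ j) (p∸i≤m∸[m+i∸p] n (toℕ i) p p≤n))
                      (+-monoʳ-≤ (toℕ i) (p∸i≤m∸[m+i∸p] n (toℕ j) q q≤n)) ⟩
        (toℕ j + (n ∸ (n + toℕ i ∸ p))) + (toℕ i + (n ∸ (n + toℕ j ∸ q)))
          ≤⟨ +-mono-≤
               -- As `(i , j)` is not a seed, the seeded end of the row starts no earlier than `j`,
               -- so it is disjoint from the first `j` vertices; likewise for the column.
               (count≥ _ _ (grid n A i) (≰⇒≥ (¬seed inactive ∘ inj₁)) (<⇒≤ (toℕ<n j))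
                 λ { j′ (inj₁ j′<j) → antidiagonal-active t i j′ (<-≤-trans (+-monoʳ-< (toℕ i) j′<j) i+j≤t)
                   ; j′ (inj₂ y≤j′) → seeds-active t i j′ (inj₁ y≤j′) })
               (count≥ _ _ (λ c → grid n A c j) (≰⇒≥ (¬seed inactive ∘ inj₂)) (<⇒≤ (toℕ<n i))
                 λ { i′ (inj₁ i′<i) → antidiagonal-active t i′ j (<-≤-trans (+-monoˡ-< (toℕ j) i′<i) i+j≤t)
                   ; i′ (inj₂ y≤i′) → seeds-active t i′ j (inj₂ y≤i′) }) ⟩
        row (grid n A) i + col (grid n A) j ∎

    seeds-percolate : Percolates (K2 n) (p + q) seeds
    seeds-percolate v =
      let i , j = remQuot {n} n v ; t = suc (toℕ i + toℕ j) in
      t , subst (λ u → active (K2 n) (p + q) seeds t u ≡ true) (combine-remQuot {n} n v)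
                (antidiagonal-active t i j ≤-refl)

theorem2p1 : (n r : ℕ) → n ≥ ((r + 1) / 2) + 1 →
    IsMinPercolatingSize (K2 n) r (((r + 1) * (r + 1)) / 4)
theorem2p1 n r n≥ = subst (IsMinPercolatingSize (K2 n) r) (quarterSquare≡ r)
  -- The construction only bounds the size of `seeds` from above; equality comes from applying the
  -- lower bound to `seeds` itself.
  ((seeds , percolates , ≤-antisym size≤ (lower seeds percolates)) , lower)
  where
  open Construction n ⌈ r /2⌉ ⌊ r /2⌋
  h<n : ⌈ r /2⌉ < n
  -- `⌈ r /2⌉` unfolds to `⌊ suc r /2⌋`, which is `(r + 1) / 2`.
  h<n = subst (_≤ n) (trans (+-comm _ 1)
    (cong suc (trans (n/2≡⌊n/2⌋ (r + 1)) (cong ⌊_/2⌋ (+-comm r 1))))) n≥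
  lower : ∀ A → Percolates (K2 n) r A → quarterSquare r ≤ size A
  lower A perc = subst (quarterSquare r ≤_) (sym (size≡total n A))
    (quarterSquare≤total r (grid n A) (percolates⇒generates A perc) h<n)
  percolates : Percolates (K2 n) r seeds
  percolates = subst (λ k → Percolates (K2 n) k seeds)
    (trans (+-comm ⌈ r /2⌉ _) (⌊n/2⌋+⌈n/2⌉≡n r))
    (seeds-percolate (<⇒≤ h<n) (≤-trans (⌊n/2⌋≤⌈n/2⌉ r) (<⇒≤ h<n)))
  size≤ : size seeds ≤ quarterSquare r
  size≤ = subst (size seeds ≤_) (sym (quarterSquare≡triangles r)) size-seeds
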